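{- We have \[ h(4,m) \geq m^2 + 9m - 3 \text{ for } m \geq 3,\qquad h(8,m) \geq m^2 + 19m - 11 \text{ for } m \geq 4,\qquad h(16,m) \geq m^2 + 33m - 17 \text{ for } m \geq 10. \]
   Context: For a real matrix $A \in \mathbb{R}^{m\times n}$ and $1 \le k \le \min\{m,n\}$, let $\Delta_k(A)$ denote the maximum of $|\det(B)|$ over all $k\times k$ submatrices $B$ of $A$. The generalized Heller constant $h(\Delta,m)$ (for $\Delta, m \in \mathbb{Z}_{>0}$) is the maximum $n \in \mathbb{Z}_{>0}$ such that there exists an integer matrix $A \in \mathbb{Z}^{m\times n}$ with pairwise distinct columns and $\Delta_m(A) = \Delta$. -}

module Defs where

open import Data.Fin.Base using (Fin; zero; suc; toℕ; _<_)
open import Data.Integer.Base using (ℤ; 1ℤ; -1ℤ; _*_; _^_; ∣_∣)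
open import Data.Integer.Properties using (+-0-commutativeMonoid)
open import Data.Nat.Base as ℕ using (ℕ; zero; suc)
open import Data.Product.Base using (_×_; ∃)
open import Data.Vec.Functional using (Vector; head; tail; transpose; removeAt)
open import Algebra.Properties.CommutativeMonoid.Sum +-0-commutativeMonoid using (sum)
open import Function.Definitions using (Injective)
open import Relation.Binary.Core using (_Preserves_⟶_)
open import Relation.Binary.PropositionalEquality using (_≡_; _≗_)

-- A i j is the entry in row i and column j.
Matrix : ℕ → ℕ → Set
Matrix m n = Vector (Vector ℤ n) m

-- Laplace expansion along the first row.
det : ∀ {n} → Matrix n n → ℤ
det {zero}  A = 1ℤ
det {suc n} A = sum λ j →
  -1ℤ ^ toℕ j * head A j * det (λ i → removeAt (tail A i) j)

IsMaximum : (ℕ → Set) → ℕ → Set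
IsMaximum P x = P x × (∀ y → P y → y ℕ.≤ x)

-- A choice of k out of n rows (or columns), listed in increasing order.
record Selection (k n : ℕ) : Set where
  field
    index      : Fin k → Fin n
    increasing : index Preserves _<_ ⟶ _<_

open Selection public

submatrix : ∀ {k l m n} → Matrix m n → Selection k m → Selection l n → Matrix k l
submatrix A r c i j = A (index r i) (index c j)

IsAbsMinor : ∀ {m n} → ℕ → Matrix m n → ℕ → Set
IsAbsMinor {m} {n} k A d =
  ∃ λ (r : Selection k m) → ∃ λ (c : Selection k n) → ∣ det (submatrix A r c) ∣ ≡ d

-- Δ⟨ k ⟩ A ≐ d says that Δ_k(A) = d.  There is no such d when k > min{m,n}.
Δ⟨_⟩_≐_ : ∀ {m n} → ℕ → Matrix m n → ℕ → Set
Δ⟨ k ⟩ A ≐ d = IsMaximum (IsAbsMinor k A) d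

DistinctColumns : ∀ {m n} → Matrix m n → Set
DistinctColumns A = Injective _≡_ _≗_ (transpose A)

HasΔModularMatrix : (Δ m n : ℕ) → Set
HasΔModularMatrix Δ m n =
  1 ℕ.≤ n × ∃ λ (A : Matrix m n) → DistinctColumns A × Δ⟨ m ⟩ A ≐ Δ

-- IsHellerConstant Δ m h says that h(Δ,m) = h.
IsHellerConstant : (Δ m h : ℕ) → Set
IsHellerConstant Δ m h = IsMaximum (HasΔModularMatrix Δ m) h

{-# OPTIONS --safe #-}
module Submission where

-- For a finite set V ⊂ ℤⁿ let Δ(V) be the largest |det| of an n × n matrix whose columns lie in
-- V − V.  Passing to the cone V′ = ({1} × V) ∪ {0} ⊂ ℤⁿ⁺¹ does not change Δ: the vectors of V′ − V′
-- are (0, V − V) and ±(1, V), and clearing the first row with a column ±(1, u) as pivot turns the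
-- others into (0, v − u).  Also |V′| = |V| + 1 and |V′ − V′| = |V − V| + 2|V|.
-- Coning s times over a point gives a unimodular simplex, whose difference set S (the roots of A_s
-- and 0) has all determinants at most 1.  By multilinearity Δ(S) ≤ 2ˢ, with equality at
-- 2e₁, …, 2e_s.  The matrix is the difference set of the (m − s)-fold cone over S for s = 2, 3, 4,
-- where |S| = 7, 13, 21 and |S − S| = 19, 55, 131.

open import Defs
open import Data.Nat.Base using (ℕ; _+_; _*_; _∸_; _^_; _≥_)
open import Data.Product.Base using (_×_)

open import Data.Fin.Base as Fin using (Fin; zero; suc; toℕ; inject₁; punchIn; punchOut)
open import Data.Fin.Induction using (<-weakInduction)
import Data.Fin.Properties as Fin
open import Data.Integer.Base as ℤ using (ℤ; 0ℤ; 1ℤ; -1ℤ; ∣_∣)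
import Data.Integer.Properties as ℤ
open import Data.Integer.Tactic.RingSolver using (solve-∀)
open import Data.List.Base as List using (List; []; _∷_; _++_; map; length; cartesianProductWith; deduplicate)
open import Data.List.Membership.Propositional using (_∈_)
open import Data.List.Membership.Propositional.Properties
open import Data.List.Properties using (length-++; length-map)
open import Data.List.Relation.Binary.Disjoint.Propositional using (Disjoint)
import Data.List.Relation.Binary.Sublist.DecPropositional as DecSublist
open import Data.List.Relation.Binary.Sublist.Propositional using (_⊆_; []; _∷_; _∷ʳ_; from∈)
open import Data.List.Relation.Binary.Sublist.Propositional.Properties using (map⁺; ++⁺; ++⁺ʳ)
open import Data.List.Relation.Unary.All as All using ([]; _∷_)
open import Data.List.Relation.Unary.AllPairs using ([]; _∷_)
open import Data.List.Relation.Unary.Any using (here)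
open import Data.List.Relation.Unary.Unique.DecPropositional.Properties using (deduplicate-!)
open import Data.List.Relation.Unary.Unique.Propositional using (Unique)
import Data.List.Relation.Unary.Unique.Propositional.Properties as Unique
import Data.Nat.Base as ℕ
import Data.Nat.Properties as ℕ
open import Data.Nat.Tactic.RingSolver renaming (solve-∀ to ℕ-solve-∀)
open import Data.Product.Base using (_,_; ∃; ∃-syntax; ∃₂; proj₁; proj₂)
open import Data.Sum.Base using (_⊎_; inj₁; inj₂)
open import Data.Vec.Base as Vec using (Vec; []; _∷_; head; tail; zipWith; lookup)
open import Data.Vec.Functional using (Vector; updateAt; removeAt)
open import Data.Vec.Functional.Properties using (updateAt-updates; updateAt-minimal; updateAt-id-local; updateAt-commutes)
import Data.Vec.Properties as Vec
open import Function.Base using (_∘_; const; id)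
open import Relation.Binary.Definitions using (Decidable; DecidableEquality)
open import Relation.Binary.PropositionalEquality
open import Relation.Nullary using (yes; no; contradiction; ¬?)
open import Relation.Nullary.Decidable using (decidable-stable; True; toWitness)

open import Algebra.Properties.Semiring.Sum ℤ.+-*-semiring
  using (sum; sum-cong-≗; sum-replicate-zero; sum-remove; ∑-distrib-+; *-distribˡ-sum)

private variable
  n : ℕ

-- Determinants of square matrices given by their columns

-- Columns are `Vec`s, so that lists of them can be searched, compared and deduplicated under
-- propositional equality.
Columns : ℕ → Set
Columns n = Vector (Vec ℤ n) n

minor : Columns (ℕ.suc n) → Fin (ℕ.suc n) → Columns n
minor c j = tail ∘ removeAt c j

cdet : Columns n → ℤ
term : Columns (ℕ.suc n) → Fin (ℕ.suc n) → ℤ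

cdet {ℕ.zero}  c = 1ℤ
cdet {ℕ.suc n} c = sum (term c)

term c j = -1ℤ ℤ.^ toℕ j ℤ.* head (c j) ℤ.* cdet (minor c j)

cdet-cong : {c c′ : Columns n} → c ≗ c′ → cdet c ≡ cdet c′
cdet-cong {ℕ.zero}  c≗c′ = refl
cdet-cong {ℕ.suc n} c≗c′ = sum-cong-≗ λ j →
  cong₂ (λ x y → -1ℤ ℤ.^ toℕ j ℤ.* x ℤ.* y)
    (cong head (c≗c′ j)) (cdet-cong (cong tail ∘ c≗c′ ∘ punchIn j))

det≡cdet : (A : Matrix n n) (c : Columns n) → (∀ i j → A i j ≡ lookup (c j) i) → det A ≡ cdet c
det≡cdet {ℕ.zero}  A c eq = refl
det≡cdet {ℕ.suc n} A c eq = sum-cong-≗ λ j →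
  cong₂ (λ x y → -1ℤ ℤ.^ toℕ j ℤ.* x ℤ.* y)
    (trans (eq zero j) (lookup-zero (c j)))
    (det≡cdet _ (minor c j) λ i k → trans (eq (suc i) (punchIn j k)) (lookup-suc (c (punchIn j k)) i))
  where
  lookup-zero : (v : Vec ℤ (ℕ.suc n)) → lookup v zero ≡ head v
  lookup-zero (_ ∷ _) = refl

  lookup-suc : (v : Vec ℤ (ℕ.suc n)) (i : Fin n) → lookup v (suc i) ≡ lookup (tail v) i
  lookup-suc (_ ∷ _) i = refl

infixl 6 _⊞[_]_
-- One operation serves for sums (`k` = 1), differences (`k` = -1) and column operations, so a
-- single linearity lemma covers them all.
_⊞[_]_ : Vec ℤ n → ℤ → Vec ℤ n → Vec ℤ n
u ⊞[ k ] v = zipWith (λ x y → x ℤ.+ k ℤ.* y) u v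

infixl 8 _[_≔_]
_[_≔_] : Columns n → Fin n → Vec ℤ n → Columns n
c [ p ≔ v ] = updateAt c p (const v)

≔-self : (c : Columns n) (p : Fin n) → c [ p ≔ c p ] ≗ c
≔-self c p = updateAt-id-local p c refl

removeAt-≔ : (c : Columns (ℕ.suc n)) (p : Fin (ℕ.suc n)) (v : Vec ℤ (ℕ.suc n)) →
             removeAt (c [ p ≔ v ]) p ≗ removeAt c p
removeAt-≔ c p v k = updateAt-minimal (punchIn p k) p c (Fin.punchInᵢ≢i p k)

minor-≔ : (c : Columns (ℕ.suc n)) {j p : Fin (ℕ.suc n)} (j≢p : j ≢ p) (v : Vec ℤ (ℕ.suc n)) →
          minor (c [ p ≔ v ]) j ≗ minor c j [ punchOut j≢p ≔ tail v ]
minor-≔ c {j} {p} j≢p v k with k Fin.≟ punchOut j≢p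
... | yes refl = begin
  tail ((c [ p ≔ v ]) (punchIn j (punchOut j≢p)))  ≡⟨ cong (tail ∘ (c [ p ≔ v ])) (Fin.punchIn-punchOut j≢p) ⟩
  tail ((c [ p ≔ v ]) p)                           ≡⟨ cong tail (updateAt-updates p c) ⟩
  tail v                                           ≡⟨ updateAt-updates (punchOut j≢p) (minor c j) ⟨
  (minor c j [ punchOut j≢p ≔ tail v ]) (punchOut j≢p) ∎
  where open ≡-Reasoning
... | no k≢ = trans
  (cong tail (updateAt-minimal (punchIn j k) p c λ eq →
    k≢ (Fin.punchIn-injective j k _ (trans eq (sym (Fin.punchIn-punchOut j≢p))))))
  (sym (updateAt-minimal k _ (minor c j) k≢))

-- Induction along the Laplace expansion: the term of column `p` is linear in its leading entry, and
-- every other term is linear through its minor, where `p` survives at position `punchOut j≢p`.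
cdet-linear : (c : Columns n) (p : Fin n) (u : Vec ℤ n) (k : ℤ) (v : Vec ℤ n) →
              cdet (c [ p ≔ u ⊞[ k ] v ]) ≡ cdet (c [ p ≔ u ]) ℤ.+ k ℤ.* cdet (c [ p ≔ v ])
cdet-linear {ℕ.suc n} c p u@(x ∷ u′) k v@(y ∷ v′) = begin
  sum (term (c [ p ≔ u ⊞[ k ] v ]))
    ≡⟨ sum-cong-≗ linear ⟩
  sum (λ j → term (c [ p ≔ u ]) j ℤ.+ k ℤ.* term (c [ p ≔ v ]) j)
    ≡⟨ ∑-distrib-+ (term (c [ p ≔ u ])) (λ j → k ℤ.* term (c [ p ≔ v ]) j) ⟩
  sum (term (c [ p ≔ u ])) ℤ.+ sum (λ j → k ℤ.* term (c [ p ≔ v ]) j)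
    ≡⟨ cong (ℤ._+_ (sum (term (c [ p ≔ u ])))) (*-distribˡ-sum k (term (c [ p ≔ v ]))) ⟨
  sum (term (c [ p ≔ u ])) ℤ.+ k ℤ.* sum (term (c [ p ≔ v ])) ∎
  where
  open ≡-Reasoning

  term-at : ∀ w → term (c [ p ≔ w ]) p ≡ -1ℤ ℤ.^ toℕ p ℤ.* head w ℤ.* cdet (minor c p)
  term-at w = cong₂ (λ a b → -1ℤ ℤ.^ toℕ p ℤ.* a ℤ.* b)
    (cong head (updateAt-updates p c)) (cdet-cong (cong tail ∘ removeAt-≔ c p w))

  term-off : ∀ {j} (j≢p : j ≢ p) w →
    term (c [ p ≔ w ]) j ≡ -1ℤ ℤ.^ toℕ j ℤ.* head (c j) ℤ.* cdet (minor c j [ punchOut j≢p ≔ tail w ])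
  term-off {j} j≢p w = cong₂ (λ a b → -1ℤ ℤ.^ toℕ j ℤ.* a ℤ.* b)
    (cong head (updateAt-minimal j p c j≢p)) (cdet-cong (minor-≔ c j≢p w))

  distrib-entry : ∀ s a k b d → s ℤ.* (a ℤ.+ k ℤ.* b) ℤ.* d ≡ s ℤ.* a ℤ.* d ℤ.+ k ℤ.* (s ℤ.* b ℤ.* d)
  distrib-entry = solve-∀

  distrib-minor : ∀ s a k d e → s ℤ.* a ℤ.* (d ℤ.+ k ℤ.* e) ≡ s ℤ.* a ℤ.* d ℤ.+ k ℤ.* (s ℤ.* a ℤ.* e)
  distrib-minor = solve-∀

  linear : ∀ j → term (c [ p ≔ u ⊞[ k ] v ]) j ≡
                 term (c [ p ≔ u ]) j ℤ.+ k ℤ.* term (c [ p ≔ v ]) j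
  linear j with j Fin.≟ p
  ... | yes refl = begin
    term (c [ p ≔ u ⊞[ k ] v ]) p
      ≡⟨ term-at (u ⊞[ k ] v) ⟩
    -1ℤ ℤ.^ toℕ p ℤ.* (x ℤ.+ k ℤ.* y) ℤ.* cdet (minor c p)
      ≡⟨ distrib-entry (-1ℤ ℤ.^ toℕ p) x k y _ ⟩
    -1ℤ ℤ.^ toℕ p ℤ.* x ℤ.* cdet (minor c p) ℤ.+ k ℤ.* (-1ℤ ℤ.^ toℕ p ℤ.* y ℤ.* cdet (minor c p))
      ≡⟨ cong₂ (λ a b → a ℤ.+ k ℤ.* b) (term-at u) (term-at v) ⟨
    term (c [ p ≔ u ]) p ℤ.+ k ℤ.* term (c [ p ≔ v ]) p ∎
  ... | no j≢p = begin
    term (c [ p ≔ u ⊞[ k ] v ]) j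
      ≡⟨ term-off j≢p (u ⊞[ k ] v) ⟩
    -1ℤ ℤ.^ toℕ j ℤ.* head (c j) ℤ.* cdet (minor c j [ punchOut j≢p ≔ u′ ⊞[ k ] v′ ])
      ≡⟨ cong (ℤ._*_ (-1ℤ ℤ.^ toℕ j ℤ.* head (c j))) (cdet-linear (minor c j) (punchOut j≢p) u′ k v′) ⟩
    -1ℤ ℤ.^ toℕ j ℤ.* head (c j) ℤ.*
      (cdet (minor c j [ punchOut j≢p ≔ u′ ]) ℤ.+ k ℤ.* cdet (minor c j [ punchOut j≢p ≔ v′ ]))
      ≡⟨ distrib-minor (-1ℤ ℤ.^ toℕ j) (head (c j)) k _ _ ⟩
    _ ≡⟨ cong₂ (λ a b → a ℤ.+ k ℤ.* b) (term-off j≢p u) (term-off j≢p v) ⟨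
    term (c [ p ≔ u ]) j ℤ.+ k ℤ.* term (c [ p ≔ v ]) j ∎

term-zero : (c : Columns (ℕ.suc n)) (j : Fin (ℕ.suc n)) → head (c j) ≡ 0ℤ → term c j ≡ 0ℤ
term-zero c j head≡0 = begin
  term c j                                   ≡⟨ cong (λ z → -1ℤ ℤ.^ toℕ j ℤ.* z ℤ.* cdet (minor c j)) head≡0 ⟩
  -1ℤ ℤ.^ toℕ j ℤ.* 0ℤ ℤ.* cdet (minor c j)  ≡⟨ cong (ℤ._* cdet (minor c j)) (ℤ.*-zeroʳ (-1ℤ ℤ.^ toℕ j)) ⟩
  0ℤ ℤ.* cdet (minor c j)                    ≡⟨ ℤ.*-zeroˡ (cdet (minor c j)) ⟩
  0ℤ                                         ∎
  where open ≡-Reasoning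

sum-zero : (f : Vector ℤ n) → (∀ j → f j ≡ 0ℤ) → sum f ≡ 0ℤ
sum-zero {n} f f≡0 = trans (sum-cong-≗ f≡0) (sum-replicate-zero n)

-- Alternation: two equal columns make the determinant vanish

sum-adjacent : (f : Vector ℤ (ℕ.suc n)) (i : Fin n) →
               (∀ j → j ≢ inject₁ i → j ≢ suc i → f j ≡ 0ℤ) →
               f (inject₁ i) ℤ.+ f (suc i) ≡ 0ℤ → sum f ≡ 0ℤ
sum-adjacent f zero rest cancel = begin
  f zero ℤ.+ (f (suc zero) ℤ.+ sum (λ j → f (suc (suc j))))
    ≡⟨ cong (λ z → f zero ℤ.+ (f (suc zero) ℤ.+ z)) (sum-zero (λ j → f (suc (suc j))) λ j → rest (suc (suc j)) (λ ()) (λ ())) ⟩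
  f zero ℤ.+ (f (suc zero) ℤ.+ 0ℤ)
    ≡⟨ cong (ℤ._+_ (f zero)) (ℤ.+-identityʳ _) ⟩
  f zero ℤ.+ f (suc zero)
    ≡⟨ cancel ⟩
  0ℤ ∎
  where open ≡-Reasoning
sum-adjacent f (suc i) rest cancel = cong₂ ℤ._+_
  (rest zero (λ ()) (λ ()))
  (sum-adjacent (f ∘ suc) i
    (λ j j≢i j≢si → rest (suc j) (j≢i ∘ Fin.suc-injective) (j≢si ∘ Fin.suc-injective)) cancel)

-- Deleting a third column leaves two neighbours adjacent, so the induction in `alternates-adjacent`
-- applies to the minor.
punchIn-adjacent : (i : Fin (ℕ.suc n)) (j : Fin (ℕ.suc (ℕ.suc n))) → j ≢ inject₁ i → j ≢ suc i →
                   ∃[ i′ ] punchIn j (inject₁ i′) ≡ inject₁ i × punchIn j (suc i′) ≡ suc i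
punchIn-adjacent         zero    zero          j≢i j≢si = contradiction refl j≢i
punchIn-adjacent         zero    (suc zero)    j≢i j≢si = contradiction refl j≢si
punchIn-adjacent {ℕ.suc _} zero    (suc (suc j)) j≢i j≢si = zero , refl , refl
punchIn-adjacent {ℕ.suc _} (suc i) zero          j≢i j≢si = i , refl , refl
punchIn-adjacent {ℕ.suc _} (suc i) (suc j)       j≢i j≢si
  with i′ , eq , eq′ ← punchIn-adjacent i j (j≢i ∘ cong suc) (j≢si ∘ cong suc) =
  suc i′ , cong suc eq , cong suc eq′

-- The minors omitting column `i` and column `i + 1` list the same columns except at one position,
-- where each shows the column that the other omits.
punchIn-inject₁-suc : (i : Fin n) (k : Fin n) →
  punchIn (inject₁ i) k ≡ punchIn (suc i) k ⊎
  punchIn (inject₁ i) k ≡ suc i × punchIn (suc i) k ≡ inject₁ i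
punchIn-inject₁-suc zero    zero    = inj₂ (refl , refl)
punchIn-inject₁-suc zero    (suc k) = inj₁ refl
punchIn-inject₁-suc (suc i) zero    = inj₁ refl
punchIn-inject₁-suc (suc i) (suc k) with punchIn-inject₁-suc i k
... | inj₁ eq         = inj₁ (cong suc eq)
... | inj₂ (eq , eq′) = inj₂ (cong suc eq , cong suc eq′)

Alternates : Fin n → Fin n → Set
Alternates {n} p q = (c : Columns n) → c p ≡ c q → cdet c ≡ 0ℤ

-- Induction on the size. Every term other than those of `i` and `i + 1` has a minor with two equal
-- neighbouring columns; these two share their entry and minor and have opposite signs.
alternates-adjacent : (i : Fin n) → Alternates (inject₁ i) (suc i)
alternates-adjacent {ℕ.suc n} i c cᵢ≡cᵢ₊₁ = sum-adjacent (term c) i rest cancel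
  where
  open ≡-Reasoning

  rest : ∀ j → j ≢ inject₁ i → j ≢ suc i → term c j ≡ 0ℤ
  rest j j≢i j≢si with i′ , eq , eq′ ← punchIn-adjacent i j j≢i j≢si =
    trans (cong (ℤ._*_ (-1ℤ ℤ.^ toℕ j ℤ.* head (c j))) minor≡0) (ℤ.*-zeroʳ (-1ℤ ℤ.^ toℕ j ℤ.* head (c j)))
    where
    minor≡0 : cdet (minor c j) ≡ 0ℤ
    minor≡0 = alternates-adjacent i′ (minor c j)
      (cong tail (trans (cong c eq) (trans cᵢ≡cᵢ₊₁ (cong c (sym eq′)))))

  same-minor : minor c (inject₁ i) ≗ minor c (suc i)
  same-minor k with punchIn-inject₁-suc i k
  ... | inj₁ eq         = cong (tail ∘ c) eq
  ... | inj₂ (eq , eq′) = cong tail (trans (cong c eq) (trans (sym cᵢ≡cᵢ₊₁) (cong c (sym eq′))))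

  opposite : ∀ s a d → s ℤ.* a ℤ.* d ℤ.+ -1ℤ ℤ.* s ℤ.* a ℤ.* d ≡ 0ℤ
  opposite = solve-∀

  cancel : term c (inject₁ i) ℤ.+ term c (suc i) ≡ 0ℤ
  cancel = begin
    term c (inject₁ i) ℤ.+ term c (suc i)
      ≡⟨ cong (ℤ._+ term c (suc i)) (cong₂ ℤ._*_
           (cong₂ ℤ._*_ (cong (-1ℤ ℤ.^_) (Fin.toℕ-inject₁ i)) (cong head cᵢ≡cᵢ₊₁))
           (cdet-cong same-minor)) ⟩
    -1ℤ ℤ.^ toℕ i ℤ.* head (c (suc i)) ℤ.* cdet (minor c (suc i)) ℤ.+ term c (suc i)
      ≡⟨ opposite (-1ℤ ℤ.^ toℕ i) _ _ ⟩
    0ℤ ∎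

-- Polarisation: expand 0 = det(…, u + v, …, u + v, …).
alternates-swap : {p q : Fin n} → p ≢ q → Alternates p q → (c : Columns n) (u v : Vec ℤ n) →
                  cdet (c [ p ≔ u ] [ q ≔ v ]) ≡ ℤ.- cdet (c [ p ≔ v ] [ q ≔ u ])
alternates-swap {n} {p} {q} p≢q alt c u v = begin
  f u v                                   ≡⟨ rearrange (f u u) (f u v) (f v u) (f v v) ⟩
  f u u ℤ.+ 1ℤ ℤ.* f u v ℤ.+ 1ℤ ℤ.* (f v u ℤ.+ 1ℤ ℤ.* f v v) ℤ.- f u u ℤ.- f v v ℤ.- f v u
    ≡⟨ cong (λ z → z ℤ.- f u u ℤ.- f v v ℤ.- f v u) (sym expand) ⟩
  f w w ℤ.- f u u ℤ.- f v v ℤ.- f v u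
    ≡⟨ cong₂ (λ a b → a ℤ.- b ℤ.- f v v ℤ.- f v u) (diag w) (diag u) ⟩
  0ℤ ℤ.- 0ℤ ℤ.- f v v ℤ.- f v u
    ≡⟨ cong (λ a → 0ℤ ℤ.- 0ℤ ℤ.- a ℤ.- f v u) (diag v) ⟩
  0ℤ ℤ.- 0ℤ ℤ.- 0ℤ ℤ.- f v u
    ≡⟨ ℤ.+-identityˡ _ ⟩
  ℤ.- f v u ∎
  where
  open ≡-Reasoning

  f : Vec ℤ n → Vec ℤ n → ℤ
  f a b = cdet (c [ p ≔ a ] [ q ≔ b ])

  w : Vec ℤ n
  w = u ⊞[ 1ℤ ] v

  diag : ∀ a → f a a ≡ 0ℤ
  diag a = alt (c [ p ≔ a ] [ q ≔ a ]) (begin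
    (c [ p ≔ a ] [ q ≔ a ]) p  ≡⟨ updateAt-minimal p q (c [ p ≔ a ]) p≢q ⟩
    (c [ p ≔ a ]) p            ≡⟨ updateAt-updates p c ⟩
    a                          ≡⟨ updateAt-updates q (c [ p ≔ a ]) ⟨
    (c [ p ≔ a ] [ q ≔ a ]) q  ∎)

  linearˡ : ∀ b → f w b ≡ f u b ℤ.+ 1ℤ ℤ.* f v b
  linearˡ b = begin
    f w b                            ≡⟨ flip w ⟩
    cdet (c [ q ≔ b ] [ p ≔ w ])     ≡⟨ cdet-linear (c [ q ≔ b ]) p u 1ℤ v ⟩
    _                                ≡⟨ cong₂ (λ x y → x ℤ.+ 1ℤ ℤ.* y) (flip u) (flip v) ⟨
    f u b ℤ.+ 1ℤ ℤ.* f v b           ∎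
    where
    flip : ∀ a → f a b ≡ cdet (c [ q ≔ b ] [ p ≔ a ])
    flip a = cdet-cong (updateAt-commutes q p (p≢q ∘ sym) c)

  expand : f w w ≡ f u u ℤ.+ 1ℤ ℤ.* f u v ℤ.+ 1ℤ ℤ.* (f v u ℤ.+ 1ℤ ℤ.* f v v)
  expand = trans (linearˡ w) (cong₂ (λ x y → x ℤ.+ 1ℤ ℤ.* y)
    (cdet-linear (c [ p ≔ u ]) q u 1ℤ v) (cdet-linear (c [ p ≔ v ]) q u 1ℤ v))

  rearrange : ∀ uu uv vu vv →
    uv ≡ uu ℤ.+ 1ℤ ℤ.* uv ℤ.+ 1ℤ ℤ.* (vu ℤ.+ 1ℤ ℤ.* vv) ℤ.- uu ℤ.- vv ℤ.- vu
  rearrange = solve-∀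

alternates-sym : {p q : Fin n} → Alternates p q → Alternates q p
alternates-sym alt c = alt c ∘ sym

-- Exchanging columns `r` and `q` only changes the sign, and it moves the equal pair from `p`, `q`
-- to `p`, `r`.
alternates-trans : {p r q : Fin n} → p ≢ r → p ≢ q → r ≢ q →
                   Alternates p r → Alternates r q → Alternates p q
alternates-trans {p = p} {r} {q} p≢r p≢q r≢q alt-pr alt-rq c cp≡cq = begin
  cdet c                                  ≡⟨ cdet-cong undo ⟨
  cdet (c [ r ≔ c r ] [ q ≔ c q ])        ≡⟨ alternates-swap r≢q alt-rq c (c r) (c q) ⟩
  ℤ.- cdet (c [ r ≔ c q ] [ q ≔ c r ])    ≡⟨ cong ℤ.-_ (alt-pr (c [ r ≔ c q ] [ q ≔ c r ]) same) ⟩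
  0ℤ ∎
  where
  open ≡-Reasoning

  undo : c [ r ≔ c r ] [ q ≔ c q ] ≗ c
  undo k = trans
    (updateAt-id-local q (c [ r ≔ c r ]) (sym (updateAt-minimal q r c (r≢q ∘ sym))) k)
    (≔-self c r k)

  same : (c [ r ≔ c q ] [ q ≔ c r ]) p ≡ (c [ r ≔ c q ] [ q ≔ c r ]) r
  same = begin
    (c [ r ≔ c q ] [ q ≔ c r ]) p  ≡⟨ updateAt-minimal p q (c [ r ≔ c q ]) p≢q ⟩
    (c [ r ≔ c q ]) p              ≡⟨ updateAt-minimal p r c p≢r ⟩
    c p                            ≡⟨ cp≡cq ⟩
    c q                            ≡⟨ updateAt-updates r c ⟨
    (c [ r ≔ c q ]) r              ≡⟨ updateAt-minimal r q (c [ r ≔ c q ]) r≢q ⟨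
    (c [ r ≔ c q ] [ q ≔ c r ]) r  ∎

-- Chains neighbouring pairs, starting from column 0. Pairs that avoid column 0 are afterwards
-- joined through it.
alternates-zero : (i : Fin n) → Alternates zero (suc i)
alternates-zero {ℕ.suc n} = <-weakInduction (λ i → Alternates zero (suc i))
  (alternates-adjacent zero)
  λ i alt → alternates-trans (λ ()) (λ ()) (λ eq → inject₁≢suc i (Fin.suc-injective eq)) alt (alternates-adjacent (suc i))
  where
  inject₁≢suc : ∀ {m} (i : Fin m) → inject₁ i ≢ suc i
  inject₁≢suc (suc i) eq = inject₁≢suc i (Fin.suc-injective eq)

alternates : {p q : Fin n} → p ≢ q → Alternates p q
alternates {p = zero}  {zero}  p≢q = contradiction refl p≢q
alternates {p = zero}  {suc q} p≢q = alternates-zero q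
alternates {p = suc p} {zero}  p≢q = alternates-sym (alternates-zero p)
alternates {p = suc p} {suc q} p≢q =
  alternates-trans (λ ()) p≢q (λ ()) (alternates-sym (alternates-zero p)) (alternates-zero q)

-- Column operations and pivots

cdet-add-column : {p q : Fin n} → p ≢ q → (c : Columns n) (k : ℤ) →
                  cdet (c [ q ≔ c q ⊞[ k ] c p ]) ≡ cdet c
cdet-add-column {p = p} {q} p≢q c k = begin
  cdet (c [ q ≔ c q ⊞[ k ] c p ])                       ≡⟨ cdet-linear c q (c q) k (c p) ⟩
  cdet (c [ q ≔ c q ]) ℤ.+ k ℤ.* cdet (c [ q ≔ c p ])  ≡⟨ cong₂ (λ a b → a ℤ.+ k ℤ.* b) (cdet-cong (≔-self c q)) repeated ⟩
  cdet c ℤ.+ k ℤ.* 0ℤ                                   ≡⟨ cong (ℤ._+_ (cdet c)) (ℤ.*-zeroʳ k) ⟩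
  cdet c ℤ.+ 0ℤ                                         ≡⟨ ℤ.+-identityʳ _ ⟩
  cdet c                                                ∎
  where
  open ≡-Reasoning
  repeated : cdet (c [ q ≔ c p ]) ≡ 0ℤ
  repeated = alternates p≢q (c [ q ≔ c p ])
    (trans (updateAt-minimal p q c p≢q) (sym (updateAt-updates q c)))

∣-1^n∣≡1 : ∀ n → ∣ -1ℤ ℤ.^ n ∣ ≡ 1
∣-1^n∣≡1 ℕ.zero    = refl
∣-1^n∣≡1 (ℕ.suc n) = trans (ℤ.abs-* -1ℤ (-1ℤ ℤ.^ n)) (cong (1 *_) (∣-1^n∣≡1 n))

-- Only the pivot's term survives in the expansion, and the absolute value removes its sign.
∣cdet∣-pivot : (c : Columns (ℕ.suc n)) (p : Fin (ℕ.suc n)) → (∀ q → q ≢ p → head (c q) ≡ 0ℤ) →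
               ∣ cdet c ∣ ≡ ∣ head (c p) ∣ * ∣ cdet (minor c p) ∣
∣cdet∣-pivot c p zeros = begin
  ∣ sum (term c) ∣                                   ≡⟨ cong ∣_∣ (sum-remove {i = p} (term c)) ⟩
  ∣ term c p ℤ.+ sum (removeAt (term c) p) ∣         ≡⟨ cong (λ z → ∣ term c p ℤ.+ z ∣) (sum-zero _ rest) ⟩
  ∣ term c p ℤ.+ 0ℤ ∣                                ≡⟨ cong ∣_∣ (ℤ.+-identityʳ (term c p)) ⟩
  ∣ -1ℤ ℤ.^ toℕ p ℤ.* head (c p) ℤ.* d ∣             ≡⟨ ℤ.abs-* (-1ℤ ℤ.^ toℕ p ℤ.* head (c p)) d ⟩
  ∣ -1ℤ ℤ.^ toℕ p ℤ.* head (c p) ∣ * ∣ d ∣           ≡⟨ cong (_* ∣ d ∣) (ℤ.abs-* (-1ℤ ℤ.^ toℕ p) (head (c p))) ⟩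
  ∣ -1ℤ ℤ.^ toℕ p ∣ * ∣ head (c p) ∣ * ∣ d ∣         ≡⟨ cong (λ z → z * ∣ head (c p) ∣ * ∣ d ∣) (∣-1^n∣≡1 (toℕ p)) ⟩
  1 * ∣ head (c p) ∣ * ∣ d ∣                         ≡⟨ cong (_* ∣ d ∣) (ℕ.*-identityˡ ∣ head (c p) ∣) ⟩
  ∣ head (c p) ∣ * ∣ d ∣                             ∎
  where
  open ≡-Reasoning
  d : ℤ
  d = cdet (minor c p)
  rest : ∀ k → removeAt (term c) p k ≡ 0ℤ
  rest k = term-zero c (punchIn p k) (zeros (punchIn p k) (Fin.punchInᵢ≢i p k))

-- The columns are changed from P to Q one at a time; T k is the claim when k of them remain in P.
module _ (P Q : Fin n → Vec ℤ n → Set) (T : ℕ → Columns n → Set)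
  (T₀ : ∀ c → (∀ i → Q i (c i)) → T 0 c)
  (Tₛ : ∀ k c j → (∀ i → P i (c i) ⊎ Q i (c i)) → P j (c j) →
        (∀ v → Q j v → T k (c [ j ≔ v ])) → T (ℕ.suc k) c)
  where

  replace-columns : ∀ c → (∀ i → P i (c i)) → T n c
  replace-columns c all-P =
    go n ℕ.≤-refl c (λ i _ → all-P i) (λ i n≤i → contradiction (Fin.toℕ<n i) (ℕ.≤⇒≯ n≤i))
    where
    -- The columns are changed from the last to the first: when `k` remain, they are those of index
    -- below `k`, and column `k` is the one changed before.
    go : ∀ k → k ℕ.≤ n → (c : Columns n) → (∀ i → toℕ i ℕ.< k → P i (c i)) →
         (∀ i → k ℕ.≤ toℕ i → Q i (c i)) → T k c
    go ℕ.zero    _   c below above = T₀ c (λ i → above i ℕ.z≤n)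
    go (ℕ.suc k) k<n c below above =
      Tₛ k c j either (below j (ℕ.s≤s (ℕ.≤-reflexive toℕj≡k))) λ v Qv → go k (ℕ.<⇒≤ k<n) (c [ j ≔ v ])
        (λ i i<k → subst (P i) (sym (updateAt-minimal i j c (i<k⇒i≢j i<k))) (below i (ℕ.m<n⇒m<1+n i<k)))
        (above′ v Qv)
      where
      j : Fin n
      j = Fin.fromℕ< k<n

      toℕj≡k : toℕ j ≡ k
      toℕj≡k = Fin.toℕ-fromℕ< k<n

      i<k⇒i≢j : ∀ {i} → toℕ i ℕ.< k → i ≢ j
      i<k⇒i≢j i<k refl = ℕ.<-irrefl toℕj≡k i<k

      either : ∀ i → P i (c i) ⊎ Q i (c i)
      either i with toℕ i ℕ.<? ℕ.suc k
      ... | yes i≤k = inj₁ (below i i≤k)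
      ... | no  i≰k = inj₂ (above i (ℕ.≮⇒≥ i≰k))

      above′ : ∀ v → Q j v → ∀ i → k ℕ.≤ toℕ i → Q i ((c [ j ≔ v ]) i)
      above′ v Qv i k≤i with i Fin.≟ j
      ... | yes refl = subst (Q j) (sym (updateAt-updates j c)) Qv
      ... | no  i≢j  = subst (Q i) (sym (updateAt-minimal i j c i≢j))
        (above i (ℕ.≤∧≢⇒< k≤i λ k≡i → i≢j (Fin.toℕ-injective (sym (trans toℕj≡k k≡i)))))

-- Difference sets and cones

infixl 6 _⊟_
_⊟_ : Vec ℤ n → Vec ℤ n → Vec ℤ n
u ⊟ v = u ⊞[ -1ℤ ] v

0ᵛ : Vec ℤ n
0ᵛ = Vec.replicate _ 0ℤ

⊟-self : (u : Vec ℤ n) → u ⊟ u ≡ 0ᵛ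
⊟-self []      = refl
⊟-self (x ∷ u) = cong₂ _∷_ (cancel x) (⊟-self u)
  where
  cancel : ∀ x → x ℤ.+ -1ℤ ℤ.* x ≡ 0ℤ
  cancel = solve-∀

⊟-0ᵛ : (u : Vec ℤ n) → u ⊟ 0ᵛ ≡ u
⊟-0ᵛ []      = refl
⊟-0ᵛ (x ∷ u) = cong₂ _∷_ (ℤ.+-identityʳ x) (⊟-0ᵛ u)

⊞-zero : (u v : Vec ℤ n) → u ⊞[ 0ℤ ] v ≡ u
⊞-zero []      []      = refl
⊞-zero (x ∷ u) (y ∷ v) = cong₂ _∷_ (drop x y) (⊞-zero u v)
  where
  drop : ∀ x y → x ℤ.+ 0ℤ ℤ.* y ≡ x
  drop = solve-∀

⊞-negʳ : (u v : Vec ℤ n) → u ⊞[ 1ℤ ] (0ᵛ ⊟ v) ≡ u ⊟ v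
⊞-negʳ []      []      = refl
⊞-negʳ (x ∷ u) (y ∷ v) = cong₂ _∷_ (eq x y) (⊞-negʳ u v)
  where
  eq : ∀ x y → x ℤ.+ 1ℤ ℤ.* (0ℤ ℤ.+ -1ℤ ℤ.* y) ≡ x ℤ.+ -1ℤ ℤ.* y
  eq = solve-∀

⊞-negˡ : (u v : Vec ℤ n) → (0ᵛ ⊟ u) ⊞[ 1ℤ ] v ≡ v ⊟ u
⊞-negˡ []      []      = refl
⊞-negˡ (x ∷ u) (y ∷ v) = cong₂ _∷_ (eq x y) (⊞-negˡ u v)
  where
  eq : ∀ x y → 0ℤ ℤ.+ -1ℤ ℤ.* x ℤ.+ 1ℤ ℤ.* y ≡ y ℤ.+ -1ℤ ℤ.* x
  eq = solve-∀

⊟-neg : (u v : Vec ℤ n) → (0ᵛ ⊟ u) ⊟ (0ᵛ ⊟ v) ≡ v ⊟ u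
⊟-neg []      []      = refl
⊟-neg (x ∷ u) (y ∷ v) = cong₂ _∷_ (eq x y) (⊟-neg u v)
  where
  eq : ∀ x y → 0ℤ ℤ.+ -1ℤ ℤ.* x ℤ.+ -1ℤ ℤ.* (0ℤ ℤ.+ -1ℤ ℤ.* y) ≡ y ℤ.+ -1ℤ ℤ.* x
  eq = solve-∀

neg-injective : {u v : Vec ℤ n} → 0ᵛ ⊟ u ≡ 0ᵛ ⊟ v → u ≡ v
neg-injective {u = u} {v} eq = begin
  u                ≡⟨ neg-involutive u ⟨
  0ᵛ ⊟ (0ᵛ ⊟ u)    ≡⟨ cong (0ᵛ ⊟_) eq ⟩
  0ᵛ ⊟ (0ᵛ ⊟ v)    ≡⟨ neg-involutive v ⟩
  v                ∎
  where
  open ≡-Reasoning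
  neg-involutive : ∀ {n} (u : Vec ℤ n) → 0ᵛ ⊟ (0ᵛ ⊟ u) ≡ u
  neg-involutive u = begin
    0ᵛ ⊟ (0ᵛ ⊟ u)          ≡⟨ cong (_⊟ (0ᵛ ⊟ u)) (⊟-0ᵛ 0ᵛ) ⟨
    (0ᵛ ⊟ 0ᵛ) ⊟ (0ᵛ ⊟ u)   ≡⟨ ⊟-neg 0ᵛ u ⟩
    u ⊟ 0ᵛ                 ≡⟨ ⊟-0ᵛ u ⟩
    u                      ∎

-- Determinant bounds for difference sets

DetBound : List (Vec ℤ n) → ℕ → Set
DetBound {n} C Δ = (c : Columns n) → (∀ j → c j ∈ C) → ∣ cdet c ∣ ℕ.≤ Δ

differences : List (Vec ℤ n) → List (Vec ℤ n)
differences C = cartesianProductWith _⊟_ C C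

-- Splitting a column `a ⊟ b` by linearity costs a factor 2, so the bound is `2 ^ k * Δ` while `k`
-- columns are still differences.
differences-bound : {C : List (Vec ℤ n)} {Δ : ℕ} → DetBound C Δ → DetBound (differences C) (2 ^ n * Δ)
differences-bound {n} {C} {Δ} bound = replace-columns
  (λ _ → _∈ differences C) (λ _ → _∈ C) (λ k c → ∣ cdet c ∣ ℕ.≤ 2 ^ k * Δ)
  (λ c c∈ → subst (∣ cdet c ∣ ℕ.≤_) (sym (ℕ.*-identityˡ Δ)) (bound c c∈))
  step
  where
  step : ∀ k c j → (∀ i → c i ∈ differences C ⊎ c i ∈ C) → c j ∈ differences C →
         (∀ v → v ∈ C → ∣ cdet (c [ j ≔ v ]) ∣ ℕ.≤ 2 ^ k * Δ) → ∣ cdet c ∣ ℕ.≤ 2 ^ ℕ.suc k * Δ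
  step k c j _ cj∈ hyp with a , b , a∈ , b∈ , cj≡a⊟b ← ∈-cartesianProductWith⁻ _⊟_ C C cj∈ = begin
    ∣ cdet c ∣                                   ≡⟨ cong ∣_∣ (cdet-cong (updateAt-id-local j c (sym cj≡a⊟b))) ⟨
    ∣ cdet (c [ j ≔ a ⊟ b ]) ∣                   ≡⟨ cong ∣_∣ (cdet-linear c j a -1ℤ b) ⟩
    ∣ dᵃ ℤ.+ -1ℤ ℤ.* dᵇ ∣                        ≤⟨ ℤ.∣i+j∣≤∣i∣+∣j∣ dᵃ (-1ℤ ℤ.* dᵇ) ⟩
    ∣ dᵃ ∣ + ∣ -1ℤ ℤ.* dᵇ ∣                      ≡⟨ cong (∣ dᵃ ∣ +_) (ℤ.abs-* -1ℤ dᵇ) ⟩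
    ∣ dᵃ ∣ + 1 * ∣ dᵇ ∣                          ≤⟨ ℕ.+-mono-≤ (hyp a a∈) (ℕ.*-monoʳ-≤ 1 (hyp b b∈)) ⟩
    2 ^ k * Δ + 1 * (2 ^ k * Δ)                  ≡⟨ ℕ.*-assoc 2 (2 ^ k) Δ ⟨
    2 ^ ℕ.suc k * Δ                              ∎
    where
    open ℕ.≤-Reasoning
    dᵃ dᵇ : ℤ
    dᵃ = cdet (c [ j ≔ a ])
    dᵇ = cdet (c [ j ≔ b ])

-- The cone over a point set

conePoints : List (Vec ℤ n) → List (Vec ℤ (ℕ.suc n))
conePoints V = map (1ℤ ∷_) V ++ 0ᵛ ∷ []

-- With `C` in the role of V - V this is V′ - V′, in blocks of first coordinate 1, 0 and -1. Height
-- 1 precedes height 0 so that a column `1ℤ ∷ base` followed by lifted columns of `C` can be found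
-- as a sublist.
coneDiffs : (V C : List (Vec ℤ n)) → List (Vec ℤ (ℕ.suc n))
coneDiffs V C = map (1ℤ ∷_) V ++ map (0ℤ ∷_) C ++ map (λ v → -1ℤ ∷ (0ᵛ ⊟ v)) V

-- A view of membership in `coneDiffs`, for case analysis on the first coordinate.
data ConeDiff (V C : List (Vec ℤ n)) : Vec ℤ (ℕ.suc n) → Set where
  up    : ∀ {v} → v ∈ V → ConeDiff V C (1ℤ ∷ v)
  level : ∀ {d} → d ∈ C → ConeDiff V C (0ℤ ∷ d)
  down  : ∀ {v} → v ∈ V → ConeDiff V C (-1ℤ ∷ (0ᵛ ⊟ v))

module _ {V C : List (Vec ℤ n)} where

  coneDiff⁺ : ∀ {x} → ConeDiff V C x → x ∈ coneDiffs V C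
  coneDiff⁺ (up v∈)    = ∈-++⁺ˡ (∈-map⁺ (1ℤ ∷_) v∈)
  coneDiff⁺ (level d∈) = ∈-++⁺ʳ (map (1ℤ ∷_) V) (∈-++⁺ˡ (∈-map⁺ (0ℤ ∷_) d∈))
  coneDiff⁺ (down v∈)  = ∈-++⁺ʳ (map (1ℤ ∷_) V) (∈-++⁺ʳ (map (0ℤ ∷_) C) (∈-map⁺ _ v∈))

  coneDiff⁻ : ∀ {x} → x ∈ coneDiffs V C → ConeDiff V C x
  coneDiff⁻ x∈ with ∈-++⁻ (map (1ℤ ∷_) V) x∈
  ... | inj₁ x∈up with _ , v∈ , refl ← ∈-map⁻ (1ℤ ∷_) x∈up = up v∈
  ... | inj₂ x∈rest with ∈-++⁻ (map (0ℤ ∷_) C) x∈rest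
  ...   | inj₁ x∈level with _ , d∈ , refl ← ∈-map⁻ (0ℤ ∷_) x∈level = level d∈
  ...   | inj₂ x∈down with _ , v∈ , refl ← ∈-map⁻ (λ v → -1ℤ ∷ (0ᵛ ⊟ v)) x∈down = down v∈

  -- The first coordinate separates the three blocks, and each block is an injective image of a list
  -- without repetitions.
  coneDiffs-unique : Unique V → Unique C → Unique (coneDiffs V C)
  coneDiffs-unique V! C! = Unique.++⁺ (Unique.map⁺ Vec.∷-injectiveʳ V!)
    (Unique.++⁺ (Unique.map⁺ Vec.∷-injectiveʳ C!) (Unique.map⁺ (neg-injective ∘ Vec.∷-injectiveʳ) V!) level#down)
    up#rest
    where
    level#down : Disjoint (map (0ℤ ∷_) C) (map (λ v → -1ℤ ∷ (0ᵛ ⊟ v)) V)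
    level#down (x∈level , x∈down)
      with _ , _ , refl ← ∈-map⁻ (0ℤ ∷_) x∈level
      with _ , _ , () ← ∈-map⁻ (λ v → -1ℤ ∷ (0ᵛ ⊟ v)) x∈down

    up#rest : Disjoint (map (1ℤ ∷_) V) (map (0ℤ ∷_) C ++ map (λ v → -1ℤ ∷ (0ᵛ ⊟ v)) V)
    up#rest (x∈up , x∈rest) with _ , _ , refl ← ∈-map⁻ (1ℤ ∷_) x∈up | ∈-++⁻ (map (0ℤ ∷_) C) x∈rest
    ... | inj₁ x∈level with _ , _ , () ← ∈-map⁻ (0ℤ ∷_) x∈level
    ... | inj₂ x∈down  with _ , _ , () ← ∈-map⁻ (λ v → -1ℤ ∷ (0ᵛ ⊟ v)) x∈down

conePoints-unique : {V : List (Vec ℤ n)} → Unique V → Unique (conePoints V)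
conePoints-unique {V = V} V! = Unique.++⁺ (Unique.map⁺ Vec.∷-injectiveʳ V!) ([] ∷ []) disjoint
  where
  disjoint : Disjoint (map (1ℤ ∷_) V) (0ᵛ ∷ [])
  disjoint (x∈ , here refl) with _ , _ , () ← ∈-map⁻ (1ℤ ∷_) x∈

module _ {V C : List (Vec ℤ n)} (V-V⊆C : ∀ {u v} → u ∈ V → v ∈ V → u ⊟ v ∈ C) where

  eliminate : ∀ {x y} → ConeDiff V C x → ConeDiff V C y → head y ≢ 0ℤ →
              ∃₂ λ k d → d ∈ C × x ⊞[ k ] y ≡ 0ℤ ∷ d
  eliminate _            (level _) y≢0 = contradiction refl y≢0
  eliminate {y = y} (level {d} d∈) (up _)    _ = 0ℤ , d , d∈ , ⊞-zero _ y
  eliminate {y = y} (level {d} d∈) (down _)  _ = 0ℤ , d , d∈ , ⊞-zero _ y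
  eliminate (up u∈)      (up v∈)   _ = -1ℤ , _ , V-V⊆C u∈ v∈ , refl
  eliminate (up u∈)      (down v∈) _ = 1ℤ , _ , V-V⊆C u∈ v∈ , cong (0ℤ ∷_) (⊞-negʳ _ _)
  eliminate (down u∈)    (up v∈)   _ = 1ℤ , _ , V-V⊆C v∈ u∈ , cong (0ℤ ∷_) (⊞-negˡ _ _)
  eliminate (down u∈)    (down v∈) _ = -1ℤ , _ , V-V⊆C v∈ u∈ , cong (0ℤ ∷_) (⊟-neg _ _)

  cone-bound : {Δ : ℕ} → DetBound C Δ → DetBound (coneDiffs V C) Δ
  cone-bound {Δ} bound c c∈ with Fin.any? (λ p → ¬? (head (c p) ℤ.≟ 0ℤ))
  -- Without a pivot the first row is zero.
  ... | no none = subst (λ z → ∣ z ∣ ℕ.≤ Δ) (sym (sum-zero (term c) zero-term)) ℕ.z≤n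
    where
    zero-term : ∀ j → term c j ≡ 0ℤ
    zero-term j = term-zero c j (decidable-stable (head (c j) ℤ.≟ 0ℤ) (λ ≢0 → none (j , ≢0)))
  -- The claim ignores the counter, since clearing a column preserves the determinant.
  ... | yes (p , pivot≢0) = replace-columns P Q (λ _ c → ∣ cdet c ∣ ℕ.≤ Δ) cleared clear c
        (λ i → c∈ i , λ { refl → refl })
    where
    -- The second components keep column `p` equal to `c p` throughout, so every other column is
    -- cleared against the same pivot.
    P Q : Fin (ℕ.suc n) → Vec ℤ (ℕ.suc n) → Set
    P i v = v ∈ coneDiffs V C × (i ≡ p → v ≡ c p)
    Q i v = (i ≢ p → ∃ λ d → d ∈ C × v ≡ 0ℤ ∷ d) × (i ≡ p → v ≡ c p)

    ∣head∣≤1 : ∀ {x} → ConeDiff V C x → ∣ head x ∣ ℕ.≤ 1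
    ∣head∣≤1 (up _)    = ℕ.≤-refl
    ∣head∣≤1 (level _) = ℕ.z≤n
    ∣head∣≤1 (down _)  = ℕ.≤-refl

    cleared : ∀ e → (∀ i → Q i (e i)) → ∣ cdet e ∣ ℕ.≤ Δ
    cleared e all-Q = begin
      ∣ cdet e ∣                                  ≡⟨ ∣cdet∣-pivot e p (λ q q≢p → let _ , _ , eq = proj₁ (all-Q q) q≢p in cong head eq) ⟩
      ∣ head (e p) ∣ * ∣ cdet (minor e p) ∣       ≤⟨ ℕ.*-mono-≤ head≤1 (bound (minor e p) minor∈) ⟩
      1 * Δ                                       ≡⟨ ℕ.*-identityˡ Δ ⟩
      Δ                                           ∎
      where
      open ℕ.≤-Reasoning
      head≤1 : ∣ head (e p) ∣ ℕ.≤ 1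
      head≤1 = subst (λ v → ∣ head v ∣ ℕ.≤ 1) (sym (proj₂ (all-Q p) refl)) (∣head∣≤1 (coneDiff⁻ (c∈ p)))

      minor∈ : ∀ k → minor e p k ∈ C
      minor∈ k with _ , d∈ , eq ← proj₁ (all-Q (punchIn p k)) (Fin.punchInᵢ≢i p k) =
        subst (_∈ C) (sym (cong tail eq)) d∈

    clear : ∀ (k : ℕ) e j → (∀ i → P i (e i) ⊎ Q i (e i)) → P j (e j) →
            (∀ v → Q j v → ∣ cdet (e [ j ≔ v ]) ∣ ℕ.≤ Δ) → ∣ cdet e ∣ ℕ.≤ Δ
    clear _ e j P∨Q (ej∈ , pivot) hyp with j Fin.≟ p
    -- The pivot column is replaced by itself.
    ... | yes refl = subst (λ z → ∣ z ∣ ℕ.≤ Δ) (cdet-cong (≔-self e j))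
                       (hyp (e j) ((λ j≢j → contradiction refl j≢j) , pivot))
    ... | no j≢p with k , d , d∈ , eq ← eliminate (coneDiff⁻ ej∈) (coneDiff⁻ (c∈ p)) pivot≢0 =
      subst (λ z → ∣ z ∣ ℕ.≤ Δ) (cdet-add-column (j≢p ∘ sym) e k)
        (hyp (e j ⊞[ k ] e p) ((λ _ → d , d∈ , trans (cong (e j ⊞[ k ]_) ep≡cp) eq) , λ j≡p → contradiction j≡p j≢p))
      where
      ep≡cp : e p ≡ c p
      ep≡cp with P∨Q p
      ... | inj₁ (_ , eq) = eq refl
      ... | inj₂ (_ , eq) = eq refl

  -- The premise `0ᵛ ∈ C` accounts for the apex minus itself.
  coneDiffs-closed : 0ᵛ ∈ C → ∀ {u v} → u ∈ conePoints V → v ∈ conePoints V → u ⊟ v ∈ coneDiffs V C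
  coneDiffs-closed 0∈C u∈ v∈ with ∈-++⁻ (map (1ℤ ∷_) V) u∈ | ∈-++⁻ (map (1ℤ ∷_) V) v∈
  ... | inj₁ u∈ | inj₁ v∈ with _ , u′∈ , refl ← ∈-map⁻ (1ℤ ∷_) u∈ | _ , v′∈ , refl ← ∈-map⁻ (1ℤ ∷_) v∈ =
    coneDiff⁺ {V = V} (level (V-V⊆C u′∈ v′∈))
  ... | inj₁ u∈ | inj₂ (here refl) with u′ , u′∈ , refl ← ∈-map⁻ (1ℤ ∷_) u∈ =
    coneDiff⁺ {V = V} (subst (ConeDiff V C ∘ (1ℤ ∷_)) (sym (⊟-0ᵛ u′)) (up u′∈))
  ... | inj₂ (here refl) | inj₁ v∈ with _ , v′∈ , refl ← ∈-map⁻ (1ℤ ∷_) v∈ = coneDiff⁺ {V = V} (down v′∈)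
  ... | inj₂ (here refl) | inj₂ (here refl) =
    coneDiff⁺ {V = V} (subst (ConeDiff V C ∘ (0ℤ ∷_)) (sym (⊟-0ᵛ 0ᵛ)) (level 0∈C))

-- Point sets with their differences and an extremal determinant

-- The extremal columns form a sublist of diffs because a Selection lists columns in increasing order.
record Configuration (n Δ : ℕ) : Set where
  field
    points        : List (Vec ℤ n)
    diffs         : List (Vec ℤ n)
    base          : Vec ℤ n
    base∈points   : base ∈ points
    points-unique : Unique points
    diffs-unique  : Unique diffs
    diffs-closed  : ∀ {u v} → u ∈ points → v ∈ points → u ⊟ v ∈ diffs
    bound         : DetBound diffs Δ
    extremal      : Vec (Vec ℤ n) n
    extremal⊆     : Vec.toList extremal ⊆ diffs
    extremal-det  : ∣ cdet (lookup extremal) ∣ ≡ Δ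

  0ᵛ∈diffs : 0ᵛ ∈ diffs
  0ᵛ∈diffs = subst (_∈ diffs) (⊟-self base) (diffs-closed base∈points base∈points)

open Configuration

-- The only vector of ℤ⁰; the empty determinant is 1, which gives Δ = 1.
point : Configuration 0 1
point = record
  { points        = [] ∷ []
  ; diffs         = [] ∷ []
  ; base          = []
  ; base∈points   = here refl
  ; points-unique = [] ∷ []
  ; diffs-unique  = [] ∷ []
  ; diffs-closed  = λ { (here refl) (here refl) → here refl }
  ; bound         = λ _ _ → ℕ.≤-refl
  ; extremal      = []
  ; extremal⊆     = [] ∷ʳ []
  ; extremal-det  = refl
  }

cone : ∀ {Δ} → Configuration n Δ → Configuration (ℕ.suc n) Δ
cone {n} {Δ} K = record
  { points        = conePoints (points K)
  ; diffs         = coneDiffs (points K) (diffs K)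
  ; base          = 0ᵛ
  ; base∈points   = ∈-++⁺ʳ (map (1ℤ ∷_) (points K)) (here refl)
  ; points-unique = conePoints-unique (points-unique K)
  ; diffs-unique  = coneDiffs-unique (points-unique K) (diffs-unique K)
  ; diffs-closed  = coneDiffs-closed (diffs-closed K) (0ᵛ∈diffs K)
  ; bound         = cone-bound (diffs-closed K) (bound K)
  ; extremal      = ws
  ; extremal⊆     = ++⁺ (map⁺ (1ℤ ∷_) (from∈ (base∈points K)))
                      (++⁺ʳ _ (subst (_⊆ map (0ℤ ∷_) (diffs K)) (sym (Vec.toList-map (0ℤ ∷_) (extremal K)))
                        (map⁺ (0ℤ ∷_) (extremal⊆ K))))
  ; extremal-det  = begin
      ∣ cdet (lookup ws) ∣                    ≡⟨ ∣cdet∣-pivot (lookup ws) zero cleared ⟩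
      1 * ∣ cdet (minor (lookup ws) zero) ∣   ≡⟨ ℕ.*-identityˡ _ ⟩
      ∣ cdet (minor (lookup ws) zero) ∣       ≡⟨ cong ∣_∣ (cdet-cong λ k → cong tail (Vec.lookup-map k (0ℤ ∷_) (extremal K))) ⟩
      ∣ cdet (lookup (extremal K)) ∣          ≡⟨ extremal-det K ⟩
      Δ                                       ∎
  }
  where
  open ≡-Reasoning
  ws : Vec (Vec ℤ (ℕ.suc n)) (ℕ.suc n)
  -- Block triangular: the lifted columns have head 0, so the pivot `1ℤ ∷ base K` leaves the
  -- determinant of `extremal K`.
  ws = (1ℤ ∷ base K) ∷ Vec.map (0ℤ ∷_) (extremal K)

  cleared : ∀ q → q ≢ zero → head (lookup ws q) ≡ 0ℤ
  cleared zero    q≢0 = contradiction refl q≢0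
  cleared (suc q) q≢0 = cong head (Vec.lookup-map q (0ℤ ∷_) (extremal K))

cones : ∀ {Δ} t → Configuration n Δ → Configuration (t + n) Δ
cones ℕ.zero    K = K
cones (ℕ.suc t) K = cone (cones t K)

-- Counting points and differences of iterated cones

length-points-cones : ∀ {Δ} t (K : Configuration n Δ) → length (points (cones t K)) ≡ t + length (points K)
length-points-cones ℕ.zero    K = refl
length-points-cones (ℕ.suc t) K = begin
  length (map (1ℤ ∷_) V ++ 0ᵛ ∷ [])   ≡⟨ length-++ (map (1ℤ ∷_) V) ⟩
  length (map (1ℤ ∷_) V) + 1          ≡⟨ ℕ.+-comm _ 1 ⟩
  1 + length (map (1ℤ ∷_) V)          ≡⟨ cong ℕ.suc (length-map (1ℤ ∷_) V) ⟩
  1 + length V                        ≡⟨ cong ℕ.suc (length-points-cones t K) ⟩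
  1 + (t + length (points K))         ∎
  where
  open ≡-Reasoning
  V : List (Vec ℤ _)
  V = points (cones t K)

-- With v points at the start, successive cones add 2v, 2(v + 1), ... differences, in total 2tv +
-- t(t - 1) after `t` cones.
length-diffs-cones : ∀ {Δ} t (K : Configuration n Δ) →
  length (diffs (cones t K)) + t ≡ length (diffs K) + 2 * t * length (points K) + t * t
length-diffs-cones ℕ.zero    K = sym (ℕ.+-identityʳ _)
length-diffs-cones (ℕ.suc t) K = begin
  length (coneDiffs V C) + ℕ.suc t               ≡⟨ cong (_+ ℕ.suc t) length-coneDiffs ⟩
  length V + (length C + length V) + ℕ.suc t     ≡⟨ cong (λ l → l + (length C + l) + ℕ.suc t) (length-points-cones t K) ⟩
  (t + v) + (length C + (t + v)) + ℕ.suc t       ≡⟨ regroup t v (length C) ⟩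
  (length C + t) + (2 * t + 2 * v + 1)           ≡⟨ cong (_+ (2 * t + 2 * v + 1)) (length-diffs-cones t K) ⟩
  length (diffs K) + 2 * t * v + t * t + (2 * t + 2 * v + 1)
                                                 ≡⟨ collect t v (length (diffs K)) ⟩
  length (diffs K) + 2 * ℕ.suc t * v + ℕ.suc t * ℕ.suc t ∎
  where
  open ≡-Reasoning
  V C : List (Vec ℤ _)
  V = points (cones t K)
  C = diffs (cones t K)

  v : ℕ
  v = length (points K)

  length-coneDiffs : length (coneDiffs V C) ≡ length V + (length C + length V)
  length-coneDiffs = begin
    length (coneDiffs V C)
      ≡⟨ length-++ (map (1ℤ ∷_) V) ⟩
    length (map (1ℤ ∷_) V) + length (map (0ℤ ∷_) C ++ map _ V)
      ≡⟨ cong₂ _+_ (length-map (1ℤ ∷_) V) (length-++ (map (0ℤ ∷_) C)) ⟩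
    length V + (length (map (0ℤ ∷_) C) + length (map _ V))
      ≡⟨ cong (length V +_) (cong₂ _+_ (length-map (0ℤ ∷_) C) (length-map _ V)) ⟩
    length V + (length C + length V) ∎

  regroup : ∀ t v c → (t + v) + (c + (t + v)) + (1 + t) ≡ (c + t) + (2 * t + 2 * v + 1)
  regroup = ℕ-solve-∀

  collect : ∀ t v d → d + 2 * t * v + t * t + (2 * t + 2 * v + 1) ≡ d + 2 * (1 + t) * v + (1 + t) * (1 + t)
  collect = ℕ-solve-∀

-- Passing from a configuration to its difference set

_≟ᵛ_ : DecidableEquality (Vec ℤ n)
_≟ᵛ_ = Vec.≡-dec ℤ._≟_

_⊆?_ : Decidable (_⊆_ {A = Vec ℤ n})
_⊆?_ = DecSublist._⊆?_ _≟ᵛ_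

doubledDiffs : ∀ {Δ} → Configuration n Δ → List (Vec ℤ n)
doubledDiffs K = deduplicate _≟ᵛ_ (differences (diffs K))

-- For iterated cones over `point` these are 2e₁, ..., 2eₙ. Each 2eᵢ is the difference of eᵢ and
-- -eᵢ, which both lie in the difference set.
doubledExtremal : ∀ {Δ} → Configuration n Δ → Vec (Vec ℤ n) n
doubledExtremal K = Vec.map (Vec.map (ℤ.+ 2 ℤ.*_)) (extremal K)

-- The differences of `K` become the points. For a concrete `K`, evaluation decides that the doubled
-- columns occur in the right order among the new differences, and `refl` proves the value of their
-- determinant.
doubled : ∀ {Δ} (K : Configuration n Δ) → {True (Vec.toList (doubledExtremal K) ⊆? doubledDiffs K)} →
          ∣ cdet (lookup (doubledExtremal K)) ∣ ≡ 2 ^ n * Δ → Configuration n (2 ^ n * Δ)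
doubled K {extremal⊆?} extremal-det = record
  { points        = diffs K
  ; diffs         = doubledDiffs K
  ; base          = 0ᵛ
  ; base∈points   = 0ᵛ∈diffs K
  ; points-unique = diffs-unique K
  ; diffs-unique  = deduplicate-! _≟ᵛ_ (differences (diffs K))
  ; diffs-closed  = λ u∈ v∈ → ∈-deduplicate⁺ _≟ᵛ_ (∈-cartesianProductWith⁺ _⊟_ u∈ v∈)
  ; bound         = λ c c∈ → differences-bound (bound K) c
                      (λ j → ∈-deduplicate⁻ _≟ᵛ_ (differences (diffs K)) (c∈ j))
  ; extremal      = doubledExtremal K
  ; extremal⊆     = toWitness extremal⊆?
  ; extremal-det  = extremal-det
  }

-- From configurations to matrices

-- Makes the choice of all rows unique. The values `f (suc i)` are nonzero, so lowering them by one
-- gives an increasing `g`, the identity by induction; then `f zero` = `suc i` = `f (suc i)` would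
-- contradict monotonicity.
increasing⇒id : (f : Fin n → Fin n) → (∀ {i j} → i Fin.< j → f i Fin.< f j) → f ≗ id
increasing⇒id {ℕ.suc n} f f-mono = λ where
    zero    → f0≡0
    (suc i) → trans (sym (suc-pred i)) (cong suc (g≗id i))
  where
  f-suc≢0 : ∀ i → zero ≢ f (suc i)
  f-suc≢0 i eq = ℕ.n≮0 (subst (f zero Fin.<_) (sym eq) (f-mono {zero} {suc i} (ℕ.s≤s ℕ.z≤n)))

  g : Fin n → Fin n
  g i = punchOut (f-suc≢0 i)

  suc-pred : ∀ i → suc (g i) ≡ f (suc i)
  suc-pred i = Fin.punchIn-punchOut (f-suc≢0 i)

  g≗id : g ≗ id
  g≗id = increasing⇒id g λ {i} {j} i<j →
    ℕ.s<s⁻¹ (subst₂ Fin._<_ (sym (suc-pred i)) (sym (suc-pred j)) (f-mono (ℕ.s<s i<j)))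

  f0≡0 : f zero ≡ zero
  f0≡0 with f zero in eq
  ... | zero  = refl
  ... | suc i = contradiction (subst₂ Fin._<_ eq f-suc-i≡ (f-mono {zero} {suc i} (ℕ.s≤s ℕ.z≤n))) (ℕ.<-irrefl refl)
    where
    f-suc-i≡ : f (suc i) ≡ suc i
    f-suc-i≡ = trans (sym (suc-pred i)) (cong suc (g≗id i))

-- A sublist embedding keeps or skips one entry at a time, so the positions it keeps increase.
sublist-selection : ∀ {A : Set} (ws : Vec A n) {xs : List A} → Vec.toList ws ⊆ xs →
  ∃ λ (σ : Selection n (length xs)) → ∀ i → lookup ws i ≡ List.lookup xs (index σ i)
sublist-selection []       []          = record { index = λ () ; increasing = λ {} } , λ ()
sublist-selection ws       (_ ∷ʳ ws⊆) with σ , eq ← sublist-selection ws ws⊆ =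
  record { index = suc ∘ index σ ; increasing = ℕ.s<s ∘ increasing σ } , eq
sublist-selection (w ∷ ws) {x ∷ xs} (w≡x ∷ ws⊆) with σ , eq ← sublist-selection ws ws⊆ =
  record { index = Fin.lift 1 (index σ) ; increasing = λ {i} {j} → mono i j } , λ where
    zero    → w≡x
    (suc i) → eq i
  where
  mono : ∀ i j → i Fin.< j → Fin.lift 1 (index σ) i Fin.< Fin.lift 1 (index σ) j
  mono zero    (suc j) _   = ℕ.z<s
  mono (suc i) (suc j) i<j = ℕ.s<s (increasing σ (ℕ.s<s⁻¹ i<j))

lookup-injective : ∀ {A : Set} {xs : List A} → Unique xs → ∀ {i j} → List.lookup xs i ≡ List.lookup xs j → i ≡ j
lookup-injective (x∉xs ∷ xs!) {zero}  {zero}  eq = refl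
lookup-injective (x∉xs ∷ xs!) {zero}  {suc j} eq = contradiction eq (All.lookup x∉xs (∈-lookup j))
lookup-injective (x∉xs ∷ xs!) {suc i} {zero}  eq = contradiction (sym eq) (All.lookup x∉xs (∈-lookup i))
lookup-injective (x∉xs ∷ xs!) {suc i} {suc j} eq = cong suc (lookup-injective xs! eq)

configuration⇒matrix : ∀ {Δ} (K : Configuration n Δ) → HasΔModularMatrix Δ n (length (diffs K))
configuration⇒matrix {n} {Δ} K =
  -- The zero column shows that the matrix has at least one column.
  ∈-length (0ᵛ∈diffs K) , A , distinct , (idₛ , σ , attained) , maximal
  where
  open ≡-Reasoning
  A : Matrix n (length (diffs K))
  A i j = lookup (List.lookup (diffs K) j) i

  distinct : DistinctColumns A
  distinct {i} {j} eq = lookup-injective (diffs-unique K) (begin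
    List.lookup (diffs K) i                          ≡⟨ Vec.tabulate∘lookup _ ⟨
    Vec.tabulate (lookup (List.lookup (diffs K) i))  ≡⟨ Vec.tabulate-cong eq ⟩
    Vec.tabulate (lookup (List.lookup (diffs K) j))  ≡⟨ Vec.tabulate∘lookup _ ⟩
    List.lookup (diffs K) j                          ∎)

  idₛ : Selection n n
  idₛ = record { index = id ; increasing = id }

  σ : Selection n (length (diffs K))
  σ = proj₁ (sublist-selection (extremal K) (extremal⊆ K))

  attained : ∣ det (submatrix A idₛ σ) ∣ ≡ Δ
  attained = trans
    (cong ∣_∣ (det≡cdet (submatrix A idₛ σ) (lookup (extremal K)) λ i j →
      cong (λ v → lookup v i) (sym (proj₂ (sublist-selection (extremal K) (extremal⊆ K)) j))))
    (extremal-det K)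

  maximal : ∀ d → IsAbsMinor n A d → d ℕ.≤ Δ
  maximal d (ρ , τ , refl) = subst (λ z → ∣ z ∣ ℕ.≤ Δ) (sym det≡) (bound K columns λ j → ∈-lookup (index τ j))
    where
    columns : Columns n
    columns j = List.lookup (diffs K) (index τ j)

    det≡ : det (submatrix A ρ τ) ≡ cdet columns
    det≡ = det≡cdet (submatrix A ρ τ) columns λ i j →
      -- The row selection `ρ` picks all `n` rows, so it is the identity.
      cong (lookup (columns j)) (increasing⇒id (index ρ) (increasing ρ) i)

-- The three starting configurations and the resulting bounds

doubledSimplex₂ : Configuration 2 4
doubledSimplex₂ = doubled (cones 2 point) refl

doubledSimplex₃ : Configuration 3 8
doubledSimplex₃ = doubled (cones 3 point) refl

doubledSimplex₄ : Configuration 4 16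
doubledSimplex₄ = doubled (cones 4 point) refl

cones-heller : ∀ {s Δ m h} (K : Configuration s Δ) → s ℕ.≤ m → IsHellerConstant Δ m h →
               h ≥ length (diffs (cones (m ∸ s) K))
cones-heller {s} {Δ} {m} {h} K s≤m (_ , h-max) = h-max _
  (subst (λ m′ → HasΔModularMatrix Δ m′ (length (diffs (cones (m ∸ s) K)))) (ℕ.m∸n+n≡m s≤m)
    (configuration⇒matrix (cones (m ∸ s) K)))

-- With t = m ∸ s, the matrix has |diffs K| + 2t|points K| + t(t − 1) columns; adding t avoids the subtraction.
heller-bound : ∀ {s Δ m h} (K : Configuration s Δ) (F : ℕ → ℕ) (a : ℕ) →
  (∀ t → F (t + s) + t ≡ length (diffs K) + 2 * t * length (points K) + t * t + a) →
  s ℕ.≤ m → IsHellerConstant Δ m h → h ≥ F m ∸ a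
heller-bound {s} {Δ} {m} {h} K F a count s≤m isHeller = begin
  F m ∸ a                ≡⟨ cong (λ m → F m ∸ a) (ℕ.m∸n+n≡m s≤m) ⟨
  F (t + s) ∸ a          ≡⟨ cong (_∸ a) F≡ ⟩
  -- `F (t + s)` is exactly `length C + a`, so the truncated subtraction loses nothing.
  length C + a ∸ a       ≡⟨ ℕ.m+n∸n≡m (length C) a ⟩
  length C               ≤⟨ cones-heller K s≤m isHeller ⟩
  h                      ∎
  where
  open ℕ.≤-Reasoning
  t : ℕ
  t = m ∸ s
  C : List (Vec ℤ (t + s))
  C = diffs (cones t K)

  shuffle : ∀ l t a → l + t + a ≡ l + a + t
  shuffle = ℕ-solve-∀

  F≡ : F (t + s) ≡ length C + a
  F≡ = ℕ.+-cancelʳ-≡ t _ _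
    (trans (count t) (trans (cong (_+ a) (sym (length-diffs-cones t K))) (shuffle (length C) t a)))

theorem1p3 : (∀ (m h : ℕ) → m ≥ 3 → IsHellerConstant 4 m h → h ≥ m ^ 2 + 9 * m ∸ 3) ×
    (∀ (m h : ℕ) → m ≥ 4 → IsHellerConstant 8 m h → h ≥ m ^ 2 + 19 * m ∸ 11) ×
    (∀ (m h : ℕ) → m ≥ 10 → IsHellerConstant 16 m h → h ≥ m ^ 2 + 33 * m ∸ 17)
theorem1p3 =
  (λ m h m≥3 → heller-bound doubledSimplex₂ (λ m → m ^ 2 + 9 * m) 3 count₂ (ℕ.≤-trans (ℕ.m≤m+n 2 1) m≥3)) ,
  (λ m h m≥4 → heller-bound doubledSimplex₃ (λ m → m ^ 2 + 19 * m) 11 count₃ (ℕ.≤-trans (ℕ.m≤m+n 3 1) m≥4)) ,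
  (λ m h m≥10 → heller-bound doubledSimplex₄ (λ m → m ^ 2 + 33 * m) 17 count₄ (ℕ.≤-trans (ℕ.m≤m+n 4 6) m≥10))
  where
  -- The square is written in its unfolded form for the ring solver. The constants 19 and 7 are the
  -- lengths of `diffs` and `points` of `doubledSimplex₂`, found by evaluation; likewise 55, 13 and
  -- 131, 21 below.
  count₂ : ∀ t → (t + 2) * ((t + 2) * 1) + 9 * (t + 2) + t ≡ 19 + 2 * t * 7 + t * t + 3
  count₂ = ℕ-solve-∀

  count₃ : ∀ t → (t + 3) * ((t + 3) * 1) + 19 * (t + 3) + t ≡ 55 + 2 * t * 13 + t * t + 11
  count₃ = ℕ-solve-∀

  count₄ : ∀ t → (t + 4) * ((t + 4) * 1) + 33 * (t + 4) + t ≡ 131 + 2 * t * 21 + t * t + 17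
  count₄ = ℕ-solve-∀
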